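{- (1) Every canonical term of observation depth $\omega$ (productive Böhm tree) is productive, i.e. every infinite trace through it contains infinitely many occurrences of constants. (2) Every $\bot$-free Böhm tree (with constants) that is productive is a canonical term of observation depth $\omega$.
   Context: Fix an infinite set of constants $c$, disjoint from the variables $x$; binders of $\lambda$-abstractions are never constants, and constants are never affected by substitution. Applications are written in head-spine form: $h\cdot(M_1;\dots;M_n)$ denotes the head $h$ (a variable or a constant) applied to the finite list of arguments $M_1,\dots,M_n$ ($\operatorname{()}$ is the empty spine). A $\bot$-free Böhm tree (with constants) is a possibly infinite tree in which every node has the form $\lambda x_1.\dots\lambda x_l.\, h\cdot(M_1;\dots;M_n)$ with $l,n$ finite and each $M_i$ again such a tree. Observation depth. For each natural number $k$ the categories of canonical terms $M_{(k)}$, neutral terms $R_{(k)}$, continuing spines $T_{(k)}$ and suspended spines $S_{(k)}$ of depth $k$ are defined as follows. At depth $0$ every tree of the category is admitted. At depth $k+1$ they are generated inductively (by finite derivations) by the grammar $M_{(k+1)} ::= \lambda x.\, M_{(k+1)} \mid R_{(k+1)}$; $R_{(k+1)} ::= x\cdot T_{(k+1)} \mid c\cdot S_{(k+1)}$; $T_{(k+1)} ::= \operatorname{()} \mid M_{(k+1)}; T_{(k+1)}$; $S_{(k+1)} ::= \operatorname{()} \mid M_{(k)}; S_{(k+1)}$. (So arguments of a variable head are observed in the same observation, while arguments of a constant head are deferred to the next depth.) A canonical term of depth $\omega$ (a productive Böhm tree) is a tree that is a canonical term of depth $k$ for every natural number $k$. Traces. The set of (possibly infinite) traces of a tree is defined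 by $\mathrm{traces}(\lambda x_1.\dots\lambda x_l.\, h\cdot(M_1;\dots;M_n)) = \{h\}$ if $n=0$, and $=\{h, T \mid T\in \bigcup_i \mathrm{traces}(M_i)\}$ if $n>0$ (i.e. a trace is the sequence of heads along a path, each element being the head of a direct child of the preceding one). A tree is productive if along each infinite trace there are infinitely many occurrences of constants. -}

module Defs where

open import Data.Nat using (ℕ; zero; suc; _≤_)
open import Data.List using (List; []; _∷_; tabulate)
open import Data.Fin using (toℕ)
open import Data.List.Membership.Propositional using (_∈_)
open import Data.Product using (∃; _×_)
open import Relation.Binary.PropositionalEquality using (_≡_)

Var : Set
Var = ℕ

Const : Set
Const = ℕ

data Head : Set where
  var : Var → Head
  con : Const → Head

-- The label of a single node  λ x₁ … λ xₗ . h · (M₁ ; … ; Mₙ) :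
-- its (finite) list of binders, its head, and its number n of arguments.
record Node : Set where
  constructor node
  field
    binders : List Var
    head    : Head
    arity   : ℕ
open Node public

-- ⊥-free Böhm trees (with constants), possibly infinite.  Coinductive types
-- are not available (--guardedness is disallowed), so a tree is represented
-- by its labelling of addresses: an address is a list of argument indices read
-- from the root, and  label a  is the node at address a.  The children of the
-- node at address a are at addresses a ++ [ i ] for i < arity; labels at
-- addresses that do not exist in the tree are irrelevant junk (nothing below
-- ever inspects them).
record BT : Set where
  constructor mkBT
  field
    label : List ℕ → Node
open BT public

rootNode : BT → Node
rootNode t = label t []

child : BT → ℕ → BT
child t i = mkBT (λ a → label t (i ∷ a))

bindersOf : BT → List Var
bindersOf t = binders (rootNode t)

headOf : BT → Head
headOf t = head (rootNode t)

args : BT → List BT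
args t = tabulate {n = arity (rootNode t)} (λ i → child t (toℕ i))

-- Canonical terms M_(k), neutral terms R_(k), continuing spines T_(k) and
-- suspended spines S_(k) of observation depth k.  The rule
-- M_(k+1) ::= λx. M_(k+1) is applied once per binder of the node (the binder
-- list is finite), after which the body must be a neutral term R_(k+1).
mutual
  data Canonical : ℕ → BT → Set where
    canon-0  : ∀ {t} → Canonical 0 t
    canon-R  : ∀ {k t} → Neutral (suc k) (headOf t) (args t) → Canonical (suc k) t

  data Neutral : ℕ → Head → List BT → Set where
    neutral-0 : ∀ {h ts} → Neutral 0 h ts
    neutral-var : ∀ {k x ts} → ContSpine (suc k) ts → Neutral (suc k) (var x) ts
    neutral-con : ∀ {k c ts} → SuspSpine (suc k) ts → Neutral (suc k) (con c) ts

  data ContSpine : ℕ → List BT → Set where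
    cont-0   : ∀ {ts} → ContSpine 0 ts
    cont-nil : ∀ {k} → ContSpine (suc k) []
    cont-cons : ∀ {k t ts} → Canonical (suc k) t → ContSpine (suc k) ts →
                ContSpine (suc k) (t ∷ ts)

  data SuspSpine : ℕ → List BT → Set where
    susp-0   : ∀ {ts} → SuspSpine 0 ts
    susp-nil : ∀ {k} → SuspSpine (suc k) []
    susp-cons : ∀ {k t ts} → Canonical k t → SuspSpine (suc k) ts →
                SuspSpine (suc k) (t ∷ ts)

CanonicalΩ : BT → Set
CanonicalΩ t = ∀ k → Canonical k t

IsInfPath : BT → (ℕ → BT) → Set
IsInfPath t nodes = (nodes 0 ≡ t) × (∀ n → nodes (suc n) ∈ args (nodes n))

InfTrace : BT → (ℕ → Head) → Set
InfTrace t hs = ∃ λ nodes → IsInfPath t nodes × (∀ n → headOf (nodes n) ≡ hs n)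

IsConst : Head → Set
IsConst h = ∃ λ c → h ≡ con c

InfinitelyManyConsts : (ℕ → Head) → Set
InfinitelyManyConsts hs = ∀ n → ∃ λ m → n ≤ m × IsConst (hs m)

Productive : BT → Set
Productive t = ∀ hs → InfTrace t hs → InfinitelyManyConsts hs

{-# OPTIONS --safe #-}
module Submission where

-- (1) Canonicity at depth k+1 is an inductive, hence finite, derivation in which only the
-- arguments of a constant head drop to depth k; so following an infinite path through a
-- tree of depth k+1 one meets a constant head after finitely many steps, and the rest of
-- the path lies in a tree of depth k.  Iterating, depth n+1 yields a constant at position ≥ n.
-- (2) Conversely, if t is not canonical at some depth, a failing argument can be chosen
-- at every node (classically), at the same depth below a variable and one depth lower
-- below a constant.  This builds an infinite path whose depths never increase and strictly
-- decrease at each constant, so it carries only finitely many constants.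

open import Defs
open import Level using (0ℓ)
open import Data.Product using (_×_)
open import Axiom.ExcludedMiddle using (ExcludedMiddle)

open import Data.Nat using (ℕ; zero; suc; _+_; _≤_; _<_; _≤′_; ≤′-refl; ≤′-step; s≤s)
open import Data.Nat.Properties
  using (≤-refl; ≤-trans; ≤-reflexive; n≤1+n; +-suc; +-identityʳ; +-monoˡ-≤; <-≤-trans; ≤⇒≤′)
open import Data.Nat.GeneralisedArithmetic using (fold)
open import Data.Nat.Induction using (<-wellFounded)
open import Data.List.Relation.Unary.All using (All; []; _∷_)
open import Data.List.Relation.Unary.All.Properties using (¬All⇒Any¬)
open import Data.List.Relation.Unary.Any using (here; there)
open import Data.List.Membership.Propositional using (_∈_; find)
open import Data.Product using (Σ; ∃; _,_; proj₁; proj₂)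
open import Data.Empty using (⊥-elim)
open import Function using (_∘_)
open import Induction.InfiniteDescent using (descent∧wf⇒empty)
open import Relation.Nullary using (¬_; yes; no)
open import Relation.Binary.PropositionalEquality using (_≡_; refl; subst; sym; trans)

suspended-lookup : ∀ {k ts u} → SuspSpine (suc k) ts → u ∈ ts → Canonical k u
suspended-lookup (susp-cons c _)  (here refl) = c
suspended-lookup (susp-cons _ ss) (there u∈) = suspended-lookup ss u∈

contSpine-from-All : ∀ {k ts} → All (Canonical (suc k)) ts → ContSpine (suc k) ts
contSpine-from-All []       = cont-nil
contSpine-from-All (c ∷ cs) = cont-cons c (contSpine-from-All cs)

suspSpine-from-All : ∀ {k ts} → All (Canonical k) ts → SuspSpine (suc k) ts
suspSpine-from-All []       = susp-nil
suspSpine-from-All (c ∷ cs) = susp-cons c (suspSpine-from-All cs)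

canonical-var : ∀ {k t x} → headOf t ≡ var x → ContSpine (suc k) (args t) → Canonical (suc k) t
canonical-var {k} {t} eq cs =
  canon-R (subst (λ h → Neutral (suc k) h (args t)) (sym eq) (neutral-var cs))

canonical-con : ∀ {k t c} → headOf t ≡ con c → SuspSpine (suc k) (args t) → Canonical (suc k) t
canonical-con {k} {t} eq ss =
  canon-R (subst (λ h → Neutral (suc k) h (args t)) (sym eq) (neutral-con ss))

module AlongPath (nodes : ℕ → BT) (step : ∀ n → nodes (suc n) ∈ args (nodes n)) where

  ConstantAhead : ℕ → ℕ → Set
  ConstantAhead k i =
    ∃ λ m → i ≤ m × IsConst (headOf (nodes m)) × Canonical k (nodes (suc m))

  mutual
    constantAhead : ∀ {k} i → Canonical (suc k) (nodes i) → ConstantAhead k i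
    constantAhead i (canon-R n) = neutralAhead i refl (step i) n

    neutralAhead : ∀ {k h ts} i → headOf (nodes i) ≡ h → nodes (suc i) ∈ ts →
                   Neutral (suc k) h ts → ConstantAhead k i
    neutralAhead i _    next (neutral-var cs)         = spineAhead i cs next
    neutralAhead i head next (neutral-con {c = c} ss) =
      i , ≤-refl , (c , head) , suspended-lookup ss next

    spineAhead : ∀ {k ts} i → ContSpine (suc k) ts → nodes (suc i) ∈ ts → ConstantAhead k i
    spineAhead i (cont-cons c _) (here refl) with constantAhead (suc i) c
    ... | m , i<m , rest = m , ≤-trans (n≤1+n i) i<m , rest
    spineAhead i (cont-cons _ cs) (there next) = spineAhead i cs next

  constantsAhead : ∀ j i → Canonical (suc j) (nodes i) →
                   ∃ λ m → i + j ≤ m × IsConst (headOf (nodes m))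
  constantsAhead zero i c with constantAhead i c
  ... | m , i≤m , const , _ = m , ≤-trans (≤-reflexive (+-identityʳ i)) i≤m , const
  constantsAhead (suc j) i c with constantAhead i c
  ... | m , i≤m , _ , rest with constantsAhead j (suc m) rest
  ... | m′ , 1+m+j≤m′ , const =
    m′ , ≤-trans (≤-reflexive (+-suc i j)) (≤-trans (s≤s (+-monoˡ-≤ j i≤m)) 1+m+j≤m′) , const

canonicalΩ⇒productive : (t : BT) → CanonicalΩ t → Productive t
canonicalΩ⇒productive t cΩ hs (nodes , (refl , step) , heads) n
  with AlongPath.constantsAhead nodes step n 0 (cΩ (suc n))
... | m , n≤m , c , eq = m , n≤m , c , trans (sym (heads m)) eq

record Failure : Set where
  constructor failure
  field
    tree  : BT
    depth : ℕ
    fails : ¬ Canonical depth tree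
open Failure

Descends : Failure → Failure → Set
Descends s s′ = tree s′ ∈ args (tree s) × depth s′ ≤ depth s ×
                (IsConst (headOf (tree s)) → depth s′ < depth s)

module Classical (lem : ExcludedMiddle 0ℓ) where

  failing-argument : ∀ {P : BT → Set} ts → ¬ All P ts → ∃ λ u → u ∈ ts × ¬ P u
  failing-argument ts ¬all = find (¬All⇒Any¬ (λ _ → lem) ts ¬all)

  descend : (s : Failure) → Σ Failure (Descends s)
  descend (failure t zero fails) = ⊥-elim (fails canon-0)
  descend (failure t (suc k) fails) with headOf t in eq
  ... | var x with failing-argument (args t) (fails ∘ canonical-var eq ∘ contSpine-from-All)
  ...   | u , u∈ , ¬u = failure u (suc k) ¬u , u∈ , ≤-refl , λ ()
  descend (failure t (suc k) fails) | con c
    with failing-argument (args t) (fails ∘ canonical-con eq ∘ suspSpine-from-All)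
  ...   | u , u∈ , ¬u = failure u k ¬u , u∈ , n≤1+n k , λ _ → ≤-refl

  module Chain (start : Failure) where

    chain : ℕ → Failure
    chain = fold start (proj₁ ∘ descend)

    descends : ∀ n → Descends (chain n) (chain (suc n))
    descends n = proj₂ (descend (chain n))

    antitone : ∀ {n m} → n ≤′ m → depth (chain m) ≤ depth (chain n)
    antitone ≤′-refl                    = ≤-refl
    antitone {m = suc m} (≤′-step n≤m) = ≤-trans (proj₁ (proj₂ (descends m))) (antitone n≤m)

    trace : ℕ → Head
    trace = headOf ∘ tree ∘ chain

    trace-is-infinite : InfTrace (tree start) trace
    trace-is-infinite = tree ∘ chain , (refl , proj₁ ∘ descends) , λ _ → refl

    finitelyManyConsts : ¬ InfinitelyManyConsts trace
    finitelyManyConsts inf =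
      descent∧wf⇒empty lowerDepth <-wellFounded (depth start) (0 , refl)
      where
      Reached : ℕ → Set
      Reached d = ∃ λ n → depth (chain n) ≡ d

      lowerDepth : ∀ {d} → Reached d → ∃ λ d′ → d′ < d × Reached d′
      lowerDepth (n , refl) with inf n
      ... | m , n≤m , const =
        depth (chain (suc m)) ,
        <-≤-trans (proj₂ (proj₂ (descends m)) const) (antitone (≤⇒≤′ n≤m)) ,
        suc m , refl

  productive⇒canonicalΩ : (t : BT) → Productive t → CanonicalΩ t
  productive⇒canonicalΩ t productive k with lem {Canonical k t}
  ... | yes c  = c
  ... | no ¬c  = ⊥-elim (finitelyManyConsts (productive trace trace-is-infinite))
    where open Chain (failure t k ¬c)

mainTheorem1 : ((t : BT) → CanonicalΩ t → Productive t)
               × (ExcludedMiddle 0ℓ → (t : BT) → Productive t → CanonicalΩ t)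
mainTheorem1 = canonicalΩ⇒productive , Classical.productive⇒canonicalΩ
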